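{- For every integer $n \ge 1$, let $P(n)$ be the number of unordered three-heap P-positions in Nim with $n$ counters in total and all heaps non-empty, i.e. the number of multisets $\{a,b,c\}$ of positive integers with $a+b+c=n$ whose bitwise XOR $a \oplus b \oplus c$ is $0$. Then $P(n) \equiv m(n) \pmod 2$.
   Context: For a non-negative integer $k$, $s_2(k)$ denotes the number of ones in the binary expansion of $k$. Define $\bar{t}(k) = 1$ if $s_2(k)$ is even and $\bar{t}(k)=0$ if $s_2(k)$ is odd. The sequence $m(n)$, $n \ge 0$, is defined by $m(2k) = \bar{t}(k)$ and $m(2k+1) = 0$ for all $k \ge 0$. The sequence $P(n)$ is OEIS A128975, indexed from $n=1$: $0,0,0,0,0,1,0,0,0,1,0,1,0,4,\ldots$. -}

module Defs where

open import Data.Bool.Base using (if_then_else_)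
open import Data.Digit using (Bit; 0b; 1b; Expansion; toDigits; fromDigits)
open import Data.Fin.Base using (zero; suc)
import Data.Fin.Properties as Fin
open import Data.List.Base
  using (List; []; _∷_; length; filter; upTo; cartesianProduct; alignWith)
open import Data.Nat.Base using (ℕ; _+_; _≤_; _<_; _/_; suc)
open import Data.Nat.Divisibility using (_∣?_)
open import Data.Nat.Properties using (_≟_; _≤?_; _<?_)
open import Data.Product.Base using (_×_; _,_; proj₁)
import Data.These.Base as These
open import Function.Base using (id)
open import Relation.Binary.PropositionalEquality using (_≡_)
open import Relation.Nullary.Decidable using (Dec; does; _×-dec_)

-- Least significant bit first.
binary : ℕ → Expansion 2
binary k = proj₁ (toDigits 2 k)

s₂ : ℕ → ℕ
s₂ k = length (filter (Fin._≟ 1b) (binary k))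

t̄ : ℕ → ℕ
t̄ k = if does (2 ∣? s₂ k) then 1 else 0

-- m (2k) = t̄ k and m (2k+1) = 0.
m : ℕ → ℕ
m n = if does (2 ∣? n) then t̄ (n / 2) else 0

infixl 6 _⊕_

xorBit : Bit → Bit → Bit
xorBit zero       b          = b
xorBit (suc zero) zero       = 1b
xorBit (suc zero) (suc zero) = 0b

-- The shorter expansion is read as padded with zeros at its most
-- significant end, so its missing bits leave the other number's bits
-- unchanged.
_⊕_ : ℕ → ℕ → ℕ
a ⊕ b = fromDigits (alignWith (These.fold id id xorBit) (binary a) (binary b))

Triple : Set
Triple = ℕ × ℕ × ℕ

-- A multiset {a,b,c} is represented by its unique nondecreasing
-- arrangement a ≤ b ≤ c.
Nondecreasing : Triple → Set
Nondecreasing (a , b , c) = a ≤ b × b ≤ c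

-- Heaps (a , b , c), all non-empty, with n counters in total and
-- nim-sum zero.
PPosition : ℕ → Triple → Set
PPosition n (a , b , c) =
  (0 < a × 0 < b × 0 < c) × a + b + c ≡ n × a ⊕ b ⊕ c ≡ 0

nondecreasing? : ∀ t → Dec (Nondecreasing t)
nondecreasing? (a , b , c) = a ≤? b ×-dec b ≤? c

pPosition? : ∀ n t → Dec (PPosition n t)
pPosition? n (a , b , c) =
  (0 <? a ×-dec 0 <? b ×-dec 0 <? c) ×-dec a + b + c ≟ n ×-dec a ⊕ b ⊕ c ≟ 0

-- All triples with entries in {0,…,n}; a + b + c ≡ n leaves no others.
triples : ℕ → List Triple
triples n = cartesianProduct heaps (cartesianProduct heaps heaps)
  where heaps = upTo (suc n)

P : ℕ → ℕ
P n = length (filter (λ t → nondecreasing? t ×-dec pPosition? n t) (triples n))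

{-# OPTIONS --safe #-}

-- Write the heaps of a zero position in binary, with n = 2k: each column
-- holds either no ones or exactly two, so column i holds two ones precisely
-- when bit i of k is set, and one then chooses which heap lacks that bit.
-- Let S k be the number of positions 0 < a < b < c (equal heaps would force
-- the third to be empty). Appending a last column to a position keeps it
-- increasing, so S (2k) = S k, while for k > 0 we get S (2k+1) = 3 S k + 1:
-- the only additional position, (1 , 2k , 2k+1), arises from (0 , k , k).
-- Hence S changes parity with each set bit of k after the leading one, at
-- which S = 0.
module Submission where

open import Defs
open import Data.Bool.Base using (if_then_else_)
open import Data.Digit using (Bit; 0b; 1b; Expansion; toDigits; fromDigits)
open import Data.Fin.Base using (zero; suc; toℕ)
import Data.Fin.Properties as Fin
open import Data.List.Base
  using (List; []; _∷_; _++_; length; filter; map; alignWith; cartesianProduct)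
open import Data.List.Membership.Propositional using (_∈_)
open import Data.List.Membership.Propositional.Properties
open import Data.List.Membership.Propositional.Properties.WithK
  using (unique∧set⇒bag)
open import Data.List.Properties
  using (length-map; map-id; length-++)
open import Data.List.Relation.Binary.BagAndSetEquality using (∼bag⇒↭)
open import Data.List.Relation.Binary.Permutation.Propositional.Properties
  using (↭-length)
open import Data.List.Relation.Unary.All using ([]; _∷_)
open import Data.List.Relation.Unary.AllPairs using ([]; _∷_)
open import Data.List.Relation.Unary.Any using (here; there)
open import Data.List.Relation.Unary.Unique.Propositional using (Unique)
import Data.List.Relation.Unary.Unique.Propositional.Properties as Unique
open import Data.Nat
  using (ℕ; zero; suc; _+_; _*_; _⊓_; _/_; _≤_; _<_; _%_; s≤s; z<s)
open import Data.Nat.Divisibility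
open import Data.Nat.DivMod using (_divMod_; result; m*n/n≡m; [m+kn]%n≡m%n)
open import Data.Nat.Properties
open import Data.Nat.Tactic.RingSolver using (solve-∀)
open import Data.Product.Base using (∃; _×_; _,_; proj₁; proj₂)
open import Data.Sum.Base using (inj₁; inj₂)
import Data.These.Base as These
open import Function.Base using (id; _∘_)
open import Function.Bundles using (mk⇔)
open import Relation.Binary.PropositionalEquality
open import Relation.Nullary.Decidable
  using (Dec; yes; no; does; dec-true; dec-false; _×-dec_)
open import Relation.Nullary.Negation using (¬_; contradiction)

-- Appending a least significant bit

infixr 7 _▹_

-- `fromDigits (i ∷ ds)` unfolds to `i ▹ fromDigits ds`, so facts about `▹` apply directly to
-- expansions.
_▹_ : Bit → ℕ → ℕ
i ▹ a = toℕ i + a * 2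

▹-injective : ∀ i j {a b} → i ▹ a ≡ j ▹ b → i ≡ j × a ≡ b
▹-injective zero       zero       eq = refl , *-cancelʳ-≡ _ _ 2 eq
▹-injective (suc zero) (suc zero) eq =
  refl , *-cancelʳ-≡ _ _ 2 (suc-injective eq)
▹-injective zero (suc zero) {a} {b} eq = contradiction
  (trans (*-comm 2 a) (trans eq (cong suc (*-comm b 2)))) (even≢odd a b)
▹-injective (suc zero) zero {a} {b} eq = contradiction
  (trans (*-comm 2 b) (trans (sym eq) (cong suc (*-comm a 2)))) (even≢odd b a)

▹≡0 : ∀ i a → i ▹ a ≡ 0 → i ≡ 0b × a ≡ 0
▹≡0 i a = ▹-injective i 0b {a} {0}

-- A bit is at most 1, so the order of distinct numbers survives whichever bits are appended.
▹-mono-< : ∀ i j {a b} → a < b → i ▹ a < j ▹ b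
▹-mono-< i j {a} {b} a<b = begin-strict
  toℕ i + a * 2 <⟨ +-monoˡ-< (a * 2) (Fin.toℕ<n i) ⟩
  suc a * 2     ≤⟨ *-monoˡ-≤ 2 a<b ⟩
  b * 2         ≤⟨ m≤n+m (b * 2) (toℕ j) ⟩
  j ▹ b         ∎
  where open ≤-Reasoning

▹-cancel-≤ : ∀ i j {a b} → i ▹ a ≤ j ▹ b → a ≤ b
▹-cancel-≤ i j le = ≮⇒≥ λ b<a → <⇒≱ (▹-mono-< j i b<a) le

-- Nim addition on bits, expansions and numbers

xorBit-comm : ∀ i j → xorBit i j ≡ xorBit j i
xorBit-comm zero       zero       = refl
xorBit-comm zero       (suc zero) = refl
xorBit-comm (suc zero) zero       = refl
xorBit-comm (suc zero) (suc zero) = refl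

xorBit-self : ∀ i → xorBit i i ≡ 0b
xorBit-self zero       = refl
xorBit-self (suc zero) = refl

xorBit≡0⇒≡ : ∀ i j → xorBit i j ≡ 0b → i ≡ j
xorBit≡0⇒≡ zero       j          eq = sym eq
xorBit≡0⇒≡ (suc zero) (suc zero) eq = refl

infixl 6 _⊻_

_⊻_ : Expansion 2 → Expansion 2 → Expansion 2
_⊻_ = alignWith (These.fold id id xorBit)

⊻-comm : ∀ xs ys → xs ⊻ ys ≡ ys ⊻ xs
⊻-comm []       []       = refl
⊻-comm []       (y ∷ ys) = refl
⊻-comm (x ∷ xs) []       = refl
⊻-comm (x ∷ xs) (y ∷ ys) = cong₂ _∷_ (xorBit-comm x y) (⊻-comm xs ys)

⊻-zeroˡ : ∀ xs ys → fromDigits xs ≡ 0 → fromDigits (xs ⊻ ys) ≡ fromDigits ys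
-- Once one list is exhausted, `alignWith` maps the identity over the other.
⊻-zeroˡ []       ys       eq = cong fromDigits (map-id ys)
⊻-zeroˡ (x ∷ xs) []       eq = trans (cong fromDigits (map-id (x ∷ xs))) eq
⊻-zeroˡ (x ∷ xs) (y ∷ ys) eq with refl , xs≡0 ← ▹≡0 x (fromDigits xs) eq =
  cong (y ▹_) (⊻-zeroˡ xs ys xs≡0)

-- Expansions of one number differ only by zeros at the most significant end, which leave the value
-- of the result unchanged.
⊻-congˡ : ∀ xs xs′ ys → fromDigits xs ≡ fromDigits xs′ →
          fromDigits (xs ⊻ ys) ≡ fromDigits (xs′ ⊻ ys)
⊻-congˡ []       xs′        ys       eq =
  trans (⊻-zeroˡ [] ys refl) (sym (⊻-zeroˡ xs′ ys (sym eq)))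
⊻-congˡ (x ∷ xs) []         ys       eq =
  trans (⊻-zeroˡ (x ∷ xs) ys eq) (sym (⊻-zeroˡ [] ys refl))
⊻-congˡ (x ∷ xs) (x′ ∷ xs′) []       eq =
  trans (cong fromDigits (map-id (x ∷ xs)))
    (trans eq (sym (cong fromDigits (map-id (x′ ∷ xs′)))))
⊻-congˡ (x ∷ xs) (x′ ∷ xs′) (y ∷ ys) eq
  with refl , xs≡xs′ ← ▹-injective x x′ eq =
  cong (xorBit x y ▹_) (⊻-congˡ xs xs′ ys xs≡xs′)

⊻-cong : ∀ xs xs′ ys ys′ →
         fromDigits xs ≡ fromDigits xs′ → fromDigits ys ≡ fromDigits ys′ →
         fromDigits (xs ⊻ ys) ≡ fromDigits (xs′ ⊻ ys′)
⊻-cong xs xs′ ys ys′ xs≡xs′ ys≡ys′ = begin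
  fromDigits (xs ⊻ ys)   ≡⟨ ⊻-congˡ xs xs′ ys xs≡xs′ ⟩
  fromDigits (xs′ ⊻ ys)  ≡⟨ cong fromDigits (⊻-comm xs′ ys) ⟩
  fromDigits (ys ⊻ xs′)  ≡⟨ ⊻-congˡ ys ys′ xs′ ys≡ys′ ⟩
  fromDigits (ys′ ⊻ xs′) ≡⟨ cong fromDigits (⊻-comm ys′ xs′) ⟩
  fromDigits (xs′ ⊻ ys′) ∎
  where open ≡-Reasoning

⊻-self : ∀ xs → fromDigits (xs ⊻ xs) ≡ 0
⊻-self []       = refl
⊻-self (x ∷ xs) = cong₂ _▹_ (xorBit-self x) (⊻-self xs)

⊻≡0⇒≡ : ∀ xs ys → fromDigits (xs ⊻ ys) ≡ 0 → fromDigits xs ≡ fromDigits ys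
⊻≡0⇒≡ []       ys       eq =
  trans (sym eq) (cong fromDigits (map-id ys))
⊻≡0⇒≡ (x ∷ xs) []       eq =
  trans (sym (cong fromDigits (map-id (x ∷ xs)))) eq
⊻≡0⇒≡ (x ∷ xs) (y ∷ ys) eq with xy≡0 , rest≡0 ←
  ▹≡0 (xorBit x y) (fromDigits (xs ⊻ ys)) eq =
  cong₂ _▹_ (xorBit≡0⇒≡ x y xy≡0) (⊻≡0⇒≡ xs ys rest≡0)

fromDigits-binary : ∀ n → fromDigits (binary n) ≡ n
fromDigits-binary n = proj₂ (toDigits 2 n)

-- Both `binary (i ▹ a)` and `i ∷ binary a` expand `i ▹ a`, so `⊻-cong` exchanges them without any
-- appeal to how `toDigits` computes.
⊕-▹ : ∀ i j a b → (i ▹ a) ⊕ (j ▹ b) ≡ xorBit i j ▹ (a ⊕ b)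
⊕-▹ i j a b =
  ⊻-cong (binary (i ▹ a)) (i ∷ binary a) (binary (j ▹ b)) (j ∷ binary b)
    (expand i a) (expand j b)
  where
  expand : ∀ i a → fromDigits (binary (i ▹ a)) ≡ i ▹ fromDigits (binary a)
  expand i a =
    trans (fromDigits-binary (i ▹ a)) (cong (i ▹_) (sym (fromDigits-binary a)))

⊕-identityˡ : ∀ a → 0 ⊕ a ≡ a
⊕-identityˡ a =
  trans (⊻-zeroˡ (binary 0) (binary a) (fromDigits-binary 0))
        (fromDigits-binary a)

⊕-self : ∀ a → a ⊕ a ≡ 0
⊕-self a = ⊻-self (binary a)

⊕≡0⇒≡ : ∀ a b → a ⊕ b ≡ 0 → a ≡ b
⊕≡0⇒≡ a b eq = trans (sym (fromDigits-binary a))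
  (trans (⊻≡0⇒≡ (binary a) (binary b) eq) (fromDigits-binary b))

-- Last columns and nim-sums of triples

Column : Set
Column = Bit × Bit × Bit

push : Column × Triple → Triple
push ((i , j , l) , (a , b , c)) = i ▹ a , j ▹ b , l ▹ c

total : Triple → ℕ
total (a , b , c) = a + b + c

xorColumn : Column → Bit
xorColumn (i , j , l) = xorBit (xorBit i j) l

-- Opaque, since unfolding _⊕_ on open terms normalises the well-founded
-- recursion of toDigits.
opaque

  nimSum : Triple → ℕ
  nimSum (a , b , c) = a ⊕ b ⊕ c

  nimSum-def : ∀ a b c → nimSum (a , b , c) ≡ a ⊕ b ⊕ c
  nimSum-def a b c = refl

  nimSum-push : ∀ q t → nimSum (push (q , t)) ≡ xorColumn q ▹ nimSum t
  nimSum-push (i , j , l) (a , b , c) =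
    trans (cong (_⊕ (l ▹ c)) (⊕-▹ i j a b)) (⊕-▹ (xorBit i j) l (a ⊕ b) c)

  nimSum-0aa : ∀ a → nimSum (0 , a , a) ≡ 0
  nimSum-0aa a = trans (cong (_⊕ a) (⊕-identityˡ a)) (⊕-self a)

  nimSum-0ab≡0⇒a≡b : ∀ a b → nimSum (0 , a , b) ≡ 0 → a ≡ b
  nimSum-0ab≡0⇒a≡b a b eq =
    ⊕≡0⇒≡ a b (trans (cong (_⊕ b) (sym (⊕-identityˡ a))) eq)

push-injective : ∀ {s t} → push s ≡ push t → s ≡ t
push-injective {(i , j , l) , (a , b , c)} {(i′ , j′ , l′) , (a′ , b′ , c′)} eq
  with refl , refl ← ▹-injective i i′ {a} {a′} (cong proj₁ eq)
  with refl , refl ← ▹-injective j j′ {b} {b′} (cong (proj₁ ∘ proj₂) eq)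
  with refl , refl ← ▹-injective l l′ {c} {c′} (cong (proj₂ ∘ proj₂) eq) = refl

pull : ∀ t → ∃ λ s → t ≡ push s
pull (a , b , c) with a divMod 2 | b divMod 2 | c divMod 2
... | result a′ i refl | result b′ j refl | result c′ l refl =
  ((i , j , l) , (a′ , b′ , c′)) , refl

-- The columns of nim-sum zero, indexed by half their number of ones, which becomes the last bit of
-- half the total.
columns : Bit → List Column
columns zero       = (0b , 0b , 0b) ∷ []
columns (suc zero) = (0b , 1b , 1b) ∷ (1b , 0b , 1b) ∷ (1b , 1b , 0b) ∷ []

columns-unique : ∀ d → Unique (columns d)
columns-unique zero       = [] ∷ []
columns-unique (suc zero) =
  ((λ ()) ∷ (λ ()) ∷ []) ∷ ((λ ()) ∷ []) ∷ [] ∷ []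

columns-sound : ∀ d {q} → q ∈ columns d → xorColumn q ≡ 0b ×
                (∀ t → total (push (q , t)) ≡ (toℕ d + total t) * 2)
columns-sound zero       (here refl) =
  refl , λ (a , b , c) → eq a b c
  where
  eq : ∀ a b c → a * 2 + b * 2 + c * 2 ≡ (a + b + c) * 2
  eq = solve-∀
columns-sound (suc zero) (here refl) =
  refl , λ (a , b , c) → eq a b c
  where
  eq : ∀ a b c → a * 2 + (1 + b * 2) + (1 + c * 2) ≡ (1 + (a + b + c)) * 2
  eq = solve-∀
columns-sound (suc zero) (there (here refl)) =
  refl , λ (a , b , c) → eq a b c
  where
  eq : ∀ a b c → 1 + a * 2 + b * 2 + (1 + c * 2) ≡ (1 + (a + b + c)) * 2
  eq = solve-∀
columns-sound (suc zero) (there (there (here refl))) =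
  refl , λ (a , b , c) → eq a b c
  where
  eq : ∀ a b c → 1 + a * 2 + (1 + b * 2) + c * 2 ≡ (1 + (a + b + c)) * 2
  eq = solve-∀

columns-complete : ∀ q → xorColumn q ≡ 0b → ∃ λ d → q ∈ columns d
columns-complete (zero     , zero     , zero)     _ = 0b , here refl
columns-complete (zero     , suc zero , suc zero) _ = 1b , here refl
columns-complete (suc zero , zero     , suc zero) _ = 1b , there (here refl)
columns-complete (suc zero , suc zero , zero)     _ =
  1b , there (there (here refl))

-- Enumeration of the zero positions

Solution : ℕ → Triple → Set
Solution k t@(a , b , c) =
  0 < a × (a < b × b < c) × total t ≡ k * 2 × nimSum t ≡ 0

-- The solution that appending a bit creates from the degenerate (0 , k , k).
boundary : Bit → ℕ → List Triple
boundary zero       k       = []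
boundary (suc zero) zero    = []
boundary (suc zero) (suc k) = (1b ▹ 0 , 0b ▹ suc k , 1b ▹ suc k) ∷ []

-- The argument expands half the total: its first digit selects the admissible last columns, and the
-- remaining digits determine the shortened heaps.
solutions : Expansion 2 → List Triple
solutions []       = []
solutions (d ∷ ds) = boundary d (fromDigits ds) ++
                     map push (cartesianProduct (columns d) (solutions ds))

boundary-sound : ∀ d k {t} → t ∈ boundary d k → Solution (d ▹ k) t
boundary-sound (suc zero) (suc k) (here refl) =
  z<s ,
  (▹-mono-< 1b 0b {0} {suc k} z<s , n<1+n _) ,
  eq (suc k) ,
  trans (nimSum-push (1b , 0b , 1b) (0 , suc k , suc k))
    (cong (_* 2) (nimSum-0aa (suc k)))
  where
  eq : ∀ k → 1 + k * 2 + (1 + k * 2) ≡ (1 + k * 2) * 2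
  eq = solve-∀

-- Strict order is what makes this work for every column: appended bits can reverse the order of two
-- equal heaps.
push-sound : ∀ d k q t → q ∈ columns d → Solution k t →
             Solution (d ▹ k) (push (q , t))
push-sound d k q@(i , j , l) t@(a , b , c) q∈ (0<a , (a<b , b<c) , sum , xor) =
  ▹-mono-< 0b i 0<a ,
  (▹-mono-< i j a<b , ▹-mono-< j l b<c) ,
  trans (proj₂ (columns-sound d q∈) t) (cong (λ s → (toℕ d + s) * 2) sum) ,
  trans (nimSum-push q t) (cong₂ _▹_ (proj₁ (columns-sound d q∈)) xor)

∈-push⁻ : ∀ d ds {t} →
          t ∈ map push (cartesianProduct (columns d) (solutions ds)) →
          ∃ λ q → ∃ λ t′ → q ∈ columns d × t′ ∈ solutions ds × t ≡ push (q , t′)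
∈-push⁻ d ds t∈ with (q , t′) , s∈ , eq ← ∈-map⁻ push t∈
  with q∈ , t′∈ ← ∈-cartesianProduct⁻ (columns d) (solutions ds) s∈ =
  q , t′ , q∈ , t′∈ , eq

solutions-sound : ∀ ds {t} → t ∈ solutions ds → Solution (fromDigits ds) t
solutions-sound (d ∷ ds) t∈ with ∈-++⁻ (boundary d (fromDigits ds)) t∈
... | inj₁ t∈ˡ = boundary-sound d (fromDigits ds) t∈ˡ
... | inj₂ t∈ʳ with q , t′ , q∈ , t′∈ , refl ← ∈-push⁻ d ds t∈ʳ =
  push-sound d (fromDigits ds) q t′ q∈ (solutions-sound ds t′∈)

-- The last column has nim-sum zero, hence an even number of ones.
nimSum≡0⇒total-even : ∀ t → nimSum t ≡ 0 → 2 ∣ total t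
nimSum≡0⇒total-even t xor with (q , t′) , refl ← pull t
  with d , q∈ ← columns-complete q
         (proj₁ (▹≡0 (xorColumn q) (nimSum t′)
           (trans (sym (nimSum-push q t′)) xor))) =
  divides (toℕ d + total t′) (proj₂ (columns-sound d q∈) t′)

-- Columns starting with 0 leave the first heap empty, and (1 , 1 , 0) puts the third heap below the
-- second. This leaves (1 , 0 , 1), which is increasing only for `k` positive.
boundary-complete : ∀ d {q} k → q ∈ columns d →
  Nondecreasing (push (q , (0 , k , k))) → 0 < proj₁ (push (q , (0 , k , k))) →
  push (q , (0 , k , k)) ∈ boundary d k
boundary-complete zero       k       (here refl) _ ()
boundary-complete (suc zero) k       (here refl) _ ()
boundary-complete (suc zero) zero    (there (here refl)) (() , _) _
boundary-complete (suc zero) (suc k) (there (here refl)) _ _ = here refl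
boundary-complete (suc zero) k (there (there (here refl))) (_ , le) _ =
  contradiction le (<⇒≱ (n<1+n (k * 2)))

-- Starts from the weak order counted by `P`; that the heaps are distinct then follows from
-- membership by `solutions-sound`.
solutions-complete : ∀ ds t → Nondecreasing t → 0 < proj₁ t →
  total t ≡ fromDigits ds * 2 → nimSum t ≡ 0 → t ∈ solutions ds
solutions-complete [] (a , b , c) _ 0<a sum _ =
  contradiction (m+n≡0⇒m≡0 a (m+n≡0⇒m≡0 (a + b) sum)) (>⇒≢ 0<a)
solutions-complete (d ∷ ds) t t↗ 0<a sum xor
  with (q@(i , j , l) , t′@(a , b , c)) , refl ← pull t
  with xorq≡0 , xor′ ←
         ▹≡0 (xorColumn q) (nimSum t′) (trans (sym (nimSum-push q t′)) xor)
  with d′ , q∈ ← columns-complete q xorq≡0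
  with divides k sum′ ← nimSum≡0⇒total-even t′ xor′
  -- Half the total is both `d′ ▹ k` and `d ▹ fromDigits ds`, so the column belongs to `d` and `t′`
  -- has total `fromDigits ds * 2`.
  with refl , refl ← ▹-injective d′ d {k} {fromDigits ds}
         (*-cancelʳ-≡ _ _ 2
           (trans (cong (λ s → (toℕ d′ + s) * 2) (sym sum′))
             (trans (sym (proj₂ (columns-sound d′ q∈) t′)) sum)))
  = go a refl
  where
  go : ∀ x → x ≡ a → push (q , t′) ∈ solutions (d ∷ ds)
  go (suc x) refl = ∈-++⁺ʳ (boundary d (fromDigits ds))
    (∈-map⁺ push (∈-cartesianProduct⁺ q∈
      (solutions-complete ds t′
        (▹-cancel-≤ i j (proj₁ t↗) , ▹-cancel-≤ j l (proj₂ t↗))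
        z<s sum′ xor′)))
  -- An empty shortened first heap makes the other two equal, and the total makes both
  -- `fromDigits ds`.
  go zero refl
    with refl ← nimSum-0ab≡0⇒a≡b b c xor′
    with refl ← *-cancelʳ-≡ b (fromDigits ds) 2
                  (trans (*-comm b 2)
                    (trans (cong (b +_) (+-identityʳ b)) sum′))
    = ∈-++⁺ˡ (boundary-complete d (fromDigits ds) q∈ t↗ 0<a)

boundary-unique : ∀ d k → Unique (boundary d k)
boundary-unique zero       k       = []
boundary-unique (suc zero) zero    = []
boundary-unique (suc zero) (suc k) = [] ∷ []

-- Separates boundary from pushed solutions, whose first heap is at least 2.
boundary-first : ∀ d k {t} → t ∈ boundary d k → proj₁ t ≡ 1
boundary-first (suc zero) (suc k) (here refl) = refl

solutions-unique : ∀ ds → Unique (solutions ds)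
solutions-unique []       = []
solutions-unique (d ∷ ds) = Unique.++⁺
  (boundary-unique d (fromDigits ds))
  (Unique.map⁺ push-injective
    (Unique.cartesianProduct⁺ (columns-unique d) (solutions-unique ds)))
  λ (t∈ˡ , t∈ʳ) → disjoint t∈ˡ (∈-push⁻ d ds t∈ʳ)
  where
  disjoint : ∀ {t} → t ∈ boundary d (fromDigits ds) →
             ¬ (∃ λ q → ∃ λ t′ →
                q ∈ columns d × t′ ∈ solutions ds × t ≡ push (q , t′))
  disjoint t∈ˡ (q@(i , _) , t′ , _ , t′∈ , refl) = <⇒≢
    (▹-mono-< 1b i (proj₁ (solutions-sound ds t′∈)))
    (sym (boundary-first d (fromDigits ds) t∈ˡ))

-- Parity of the number of solutions

popcount : Expansion 2 → ℕ
popcount ds = length (filter (Fin._≟ 1b) ds)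

length-cartesianProduct : ∀ {A B : Set} (xs : List A) (ys : List B) →
  length (cartesianProduct xs ys) ≡ length xs * length ys
length-cartesianProduct []       ys = refl
length-cartesianProduct (x ∷ xs) ys = trans (length-++ (map (x ,_) ys))
  (cong₂ _+_ (length-map (x ,_) ys) (length-cartesianProduct xs ys))

length-solutions : ∀ d ds → length (solutions (d ∷ ds)) ≡
  length (boundary d (fromDigits ds)) +
  length (columns d) * length (solutions ds)
length-solutions d ds = trans (length-++ (boundary d (fromDigits ds)))
  (cong (length (boundary d (fromDigits ds)) +_)
    (trans (length-map push (cartesianProduct (columns d) (solutions ds)))
      (length-cartesianProduct (columns d) (solutions ds))))

-- The term 1 ⊓ k accounts for the degenerate position (0 , k , k), k > 0.
solutions-parity : ∀ ds →
  2 ∣ length (solutions ds) + popcount ds + 1 ⊓ fromDigits ds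
solutions-parity []       = divides 0 refl
solutions-parity (d ∷ ds) rewrite length-solutions d ds =
  step d (fromDigits ds) (solutions-parity ds)
  where
  ℓ = length (solutions ds)
  p = popcount ds

  even-change : ∀ {x y} w → y ≡ w * 2 + x → 2 ∣ x → 2 ∣ y
  even-change w refl 2∣x = ∣m∣n⇒∣m+n (n∣m*n w) 2∣x

  step : ∀ d k → 2 ∣ ℓ + p + 1 ⊓ k →
    2 ∣ length (boundary d k) + length (columns d) * ℓ +
        popcount (d ∷ ds) + 1 ⊓ (d ▹ k)
  step zero       zero    = even-change 0 (eq ℓ p)
    where
    eq : ∀ ℓ p → 1 * ℓ + p + 0 ≡ ℓ + p + 0
    eq = solve-∀
  step zero       (suc k) = even-change 0 (eq ℓ p)
    where
    eq : ∀ ℓ p → 1 * ℓ + p + 1 ≡ ℓ + p + 1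
    eq = solve-∀
  -- Digit 1 always adds `2 * ℓ + 2`: two further copies of `ℓ`, one from `popcount`, and one either
  -- from `1 ⊓ k` rising to 1 (here) or from `boundary` (next clause).
  step (suc zero) zero    = even-change (1 + ℓ) (eq ℓ p)
    where
    eq : ∀ ℓ p → 3 * ℓ + (1 + p) + 1 ≡ (1 + ℓ) * 2 + (ℓ + p + 0)
    eq = solve-∀
  step (suc zero) (suc k) = even-change (1 + ℓ) (eq ℓ p)
    where
    eq : ∀ ℓ p → 1 + 3 * ℓ + (1 + p) + 1 ≡ (1 + ℓ) * 2 + (ℓ + p + 1)
    eq = solve-∀

-- Comparison of the enumeration with the count

∈-triples : ∀ {n a b c} → a + b + c ≡ n → (a , b , c) ∈ triples n
∈-triples {n} {a} {b} {c} refl = ∈-cartesianProduct⁺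
  (∈-upTo⁺ (s≤s (≤-trans (m≤m+n a b) (m≤m+n (a + b) c))))
  (∈-cartesianProduct⁺
    (∈-upTo⁺ (s≤s (≤-trans (m≤n+m b a) (m≤m+n (a + b) c))))
    (∈-upTo⁺ (s≤s (m≤n+m c (a + b)))))

triples-unique : ∀ n → Unique (triples n)
triples-unique n = Unique.cartesianProduct⁺ heaps
  (Unique.cartesianProduct⁺ heaps heaps)
  where heaps = Unique.upTo⁺ (suc n)

counted? : ∀ n t → Dec (Nondecreasing t × PPosition n t)
counted? n t = nondecreasing? t ×-dec pPosition? n t

-- Two duplicate-free lists with the same members are permutations of each other.
P≡length-solutions : ∀ ds → P (fromDigits ds * 2) ≡ length (solutions ds)
P≡length-solutions ds = ↭-length (∼bag⇒↭ (unique∧set⇒bag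
  (Unique.filter⁺ (counted? n) (triples-unique n))
  (solutions-unique ds)
  (mk⇔ to from)))
  where
  n = fromDigits ds * 2

  to : ∀ {t} → t ∈ filter (counted? n) (triples n) → t ∈ solutions ds
  to {t@(a , b , c)} t∈ =
    let _ , t↗ , (0<a , _) , sum , xor =
          ∈-filter⁻ (counted? n) {xs = triples n} t∈
    in solutions-complete ds t t↗ 0<a sum (trans (nimSum-def a b c) xor)

  from : ∀ {t} → t ∈ solutions ds → t ∈ filter (counted? n) (triples n)
  from {a , b , c} t∈ =
    let 0<a , (a<b , b<c) , sum , xor = solutions-sound ds t∈
    in ∈-filter⁺ (counted? n) (∈-triples sum)
         ( (<⇒≤ a<b , <⇒≤ b<c)
         , (0<a , <-trans 0<a a<b , <-trans 0<a (<-trans a<b b<c))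
         , sum , trans (sym (nimSum-def a b c)) xor)

P-odd : ∀ n → ¬ 2 ∣ n → P n ≡ 0
P-odd n 2∤n = empty (filter (counted? n) (triples n)) λ {(a , b , c)} t∈ →
  let _ , _ , _ , sum , xor = ∈-filter⁻ (counted? n) {xs = triples n} t∈
  in 2∤n (subst (2 ∣_) sum
       (nimSum≡0⇒total-even (a , b , c) (trans (nimSum-def a b c) xor)))
  where
  empty : ∀ (ts : List Triple) → (∀ {t} → ¬ t ∈ ts) → length ts ≡ 0
  empty []       ∉ts = refl
  empty (t ∷ ts) ∉ts = contradiction (here refl) ∉ts

-- Comparison of parities

m-even : ∀ k → m (k * 2) ≡ t̄ k
m-even k = cong₂ (λ b x → if b then x else 0)
  (dec-true (2 ∣? k * 2) (n∣m*n k)) (cong t̄ (m*n/n≡m k 2))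

2∤n⇒2∣1+n : ∀ n → ¬ 2 ∣ n → 2 ∣ suc n
2∤n⇒2∣1+n n 2∤n with n divMod 2
... | result q zero       eq = contradiction (divides q eq) 2∤n
... | result q (suc zero) eq = divides (suc q) (cong suc eq)

2∣1+n⇒n%2≡1 : ∀ n → 2 ∣ suc n → n % 2 ≡ 1
2∣1+n⇒n%2≡1 n (divides (suc q) eq) =
  trans (cong (_% 2) (suc-injective eq)) ([m+kn]%n≡m%n 1 q 2)

-- For `s` the number of ones of `k`, the conditional is `t̄ k`; the final 1 in the hypothesis is
-- the value of `1 ⊓ k` for positive `k`.
parity-complement : ∀ ℓ s → 2 ∣ ℓ + s + 1 →
  ℓ % 2 ≡ (if does (2 ∣? s) then 1 else 0) % 2
parity-complement ℓ s even = helper (2 ∣? s)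
  where
  -- Abstracting the decision lets the conditional reduce in each case.
  helper : (s? : Dec (2 ∣ s)) → ℓ % 2 ≡ (if does s? then 1 else 0) % 2
  helper (yes 2∣s) = 2∣1+n⇒n%2≡1 ℓ
    (∣m+n∣m⇒∣n (subst (2 ∣_) (eq ℓ s) even) 2∣s)
    where
    eq : ∀ ℓ s → ℓ + s + 1 ≡ s + suc ℓ
    eq = solve-∀
  helper (no 2∤s) = n∣m⇒m%n≡0 ℓ 2
    (∣m+n∣m⇒∣n (subst (2 ∣_) (eq ℓ s) even) (2∤n⇒2∣1+n s 2∤s))
    where
    eq : ∀ ℓ s → ℓ + s + 1 ≡ suc s + ℓ
    eq = solve-∀

m-odd : ∀ n → ¬ 2 ∣ n → m n ≡ 0
m-odd n 2∤n = cong (if_then t̄ (n / 2) else 0) (dec-false (2 ∣? n) 2∤n)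

-- Positivity matters: for `k` zero there is no position, while `t̄ 0` is 1.
P-even : ∀ k → 0 < k → P (k * 2) % 2 ≡ t̄ k % 2
P-even k 0<k = begin
  P (k * 2) % 2             ≡⟨ cong (λ x → P (x * 2) % 2) value ⟨
  P (fromDigits ds * 2) % 2 ≡⟨ cong (_% 2) (P≡length-solutions ds) ⟩
  length (solutions ds) % 2 ≡⟨ parity-complement _ (popcount ds) even ⟩
  t̄ k % 2                   ∎
  where
  open ≡-Reasoning
  ds = binary k
  value = fromDigits-binary k
  even : 2 ∣ length (solutions ds) + popcount ds + 1
  even = subst (λ x → 2 ∣ length (solutions ds) + popcount ds + x)
    (trans (cong (1 ⊓_) value) (m≤n⇒m⊓n≡m 0<k)) (solutions-parity ds)

lemma2 : (n : ℕ) → 1 ≤ n → P n % 2 ≡ m n % 2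
lemma2 n 1≤n = helper (2 ∣? n)
  where
  helper : Dec (2 ∣ n) → P n % 2 ≡ m n % 2
  helper (yes (divides k n≡k*2)) =
    subst (λ x → P x % 2 ≡ m x % 2) (sym n≡k*2)
      (trans (P-even k (n≢0⇒n>0 (λ { refl → >⇒≢ 1≤n n≡k*2 })))
        (cong (_% 2) (sym (m-even k))))
  helper (no 2∤n) = cong (_% 2) (trans (P-odd n 2∤n) (sym (m-odd n 2∤n)))
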